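{- Up to isomorphism, all Möbius $n$-pairs ($n\ge 4$) with a special decomposition are the following: 1. $\mathfrak{M}_{(4,\mathrm{id})}$, with $3$ distinct special decompositions, associated with $X=\{1,2\},\{1,3\},\{1,4\}$; 2. $\mathfrak{M}_{(4,(13)(24))}$, with the (unique) special decomposition associated with $X=\{1,3\}$; 3. $\mathfrak{M}_{(4,(12)(3)(4))}$, with the (unique) special decomposition associated with $X=\{1,2\}$.
   Context: A configuration is a pair $\langle S,\mathcal L\rangle$ of a point set $S$ and a family $\mathcal L$ of subsets of $S$ (blocks); an isomorphism is a bijection of the point sets under which a set of points is a block iff its image is a block. Let $n\ge 3$, $I=\{1,\dots,n\}$, $\varphi\in S_n$ a permutation of $I$, and let $A=\{a_1,\dots,a_n\}$, $B=\{b_1,\dots,b_n\}$ be disjoint $n$-element sets. For $i\in I$ put $A_i=(A\setminus\{a_i\})\cup\{b_i\}$ and $B_i=(B\setminus\{b_i\})\cup\{a_{\varphi(i)}\}$, $\mathcal L_A=\{A_i:i\in I\}$, $\mathcal L_B=\{B_i:i\in I\}$. The Möbius $n$-pair $\mathcal M=\mathfrak{M}_{(n,\varphi)}$ is the configuration with point set $A\cup B$ and block set $\mathcal L_A\cup\mathcal L_B$. Its standard simplices are $S_A(\mathcal M)=\langle A,\mathcal L_A\rangle$ and $S_B(\mathcal M)=\langle B,\mathcal L_B\rangle$. A decomposition of $\mathcal M$ into two complementary, mutually inscribed simplices $S_1=\langle P_1,\mathcal K_1\rangle$, $S_2=\langle P_2,\mathcal K_2\rangle$ (an unordered pair) consists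 of a partition $P_1\sqcup P_2$ of the points into two $n$-sets and a partition $\mathcal K_1\sqcup\mathcal K_2$ of the blocks into two $n$-sets such that: for $t=1,2$ every point of $P_t$ lies on all but exactly one of the blocks in $\mathcal K_t$, and every block in $\mathcal K_t$ contains all but exactly one of the points of $P_t$; and for $s\ne t$ every point of $P_t$ lies on exactly one block of $\mathcal K_s$, and every block of $\mathcal K_t$ contains exactly one point of $P_s$. For $n\ge 4$, it is called a special decomposition if $S_t\neq S_A(\mathcal M)$ and $S_t\ne S_B(\mathcal M)$ for $t=1,2$. For $n=4$ and a $2$-subset $X\subset I$ with $\varphi(X)=X$, the special decomposition associated with $X$ has one simplex with points $a_i$ ($i\in X$), $b_j$ ($j\in I\setminus X$) and blocks $B_i$ ($i\in X$), $A_j$ ($j\in I\setminus X$), the other simplex consisting of the remaining points and blocks. (Thus $X$ and $I\setminus X$ give the same decomposition.) -}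

module Defs where

open import Level using (0ℓ)
open import Data.Nat using (ℕ; _+_)
open import Data.Fin using (Fin; _↑ˡ_; _↑ʳ_)
open import Data.Fin.Permutation
  using (Permutation; Permutation′; _⟨$⟩ʳ_; _⟨$⟩ˡ_; transpose; _∘ₚ_)
open import Data.Fin.Subset
open import Data.Product using (Σ-syntax; ∃-syntax; ∃!; _×_; _,_)
open import Data.Sum using (_⊎_)
open import Data.Vec using (_++_; lookup; tabulate)
open import Function using (_⇔_; Injective)
open import Relation.Binary.PropositionalEquality using (_≡_)
open import Relation.Nullary using (¬_)
open import Relation.Unary as U using (Pred)

-- Families of subsets of an m-element set; equality of families is the
-- extensional U._≐_.
Family : ℕ → Set₁
Family m = Pred (Subset m) 0ℓ

HasSize : ∀ {m} → Family m → ℕ → Set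
HasSize {m} 𝒦 n = Σ[ e ∈ (Fin n → Subset m) ]
  Injective _≡_ _≡_ e × (∀ k → 𝒦 k ⇔ (∃[ i ] k ≡ e i))

record Configuration : Set₁ where
  constructor ⟨_,_⟩
  field
    order : ℕ
    Block : Family order

open Configuration public

-- y lies in the image of X under π iff π⁻¹ y lies in X.
image : ∀ {m n} → Permutation m n → Subset m → Subset n
image π X = tabulate λ y → lookup X (π ⟨$⟩ˡ y)

infix 4 _≅_

_≅_ : Configuration → Configuration → Set
M ≅ N = Σ[ π ∈ Permutation (order M) (order N) ]
  (∀ X → Block M X ⇔ Block N (image π X))

-- The point set A ∪ B is Fin (n + n), the first n elements being
-- a₁, …, aₙ and the last n being b₁, …, bₙ.  Indices are counted from 0.
a b : ∀ {n} → Fin n → Fin (n + n)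
a {n} i = i ↑ˡ n
b {n} i = n ↑ʳ i

A B : (n : ℕ) → Subset (n + n)
A n = ⊤ {n} ++ ⊥ {n}
B n = ⊥ {n} ++ ⊤ {n}

blockA blockB : ∀ {n} → Permutation′ n → Fin n → Subset (n + n)
blockA {n} φ i = (A n - a i) ∪ ⁅ b i ⁆
blockB {n} φ i = (B n - b i) ∪ ⁅ a (φ ⟨$⟩ʳ i) ⁆

ℒA ℒB : ∀ {n} → Permutation′ n → Family (n + n)
ℒA φ k = ∃[ i ] k ≡ blockA φ i
ℒB φ k = ∃[ i ] k ≡ blockB φ i

𝔐 : (n : ℕ) → Permutation′ n → Configuration
𝔐 n φ = ⟨ n + n , ℒA φ U.∪ ℒB φ ⟩

-- A set of points and a set of blocks of an ambient configuration.  The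
-- blocks need not be contained in the point set of the part.
record Part (m : ℕ) : Set₁ where
  constructor ⟪_,_⟫
  field
    points : Subset m
    blocks : Family m

open Part public

infix 4 _≈_

_≈_ : ∀ {m} → Part m → Part m → Set
S ≈ T = points S ≡ points T × blocks S U.≐ blocks T

S-A S-B : ∀ {n} → Permutation′ n → Part (n + n)
S-A {n} φ = ⟪ A n , ℒA φ ⟫
S-B {n} φ = ⟪ B n , ℒB φ ⟫

record IsSimplex {m} (S : Part m) : Set where
  field
    point-misses-one-block :
      ∀ {x} → x ∈ points S → ∃! _≡_ λ k → blocks S k × x ∉ k
    block-misses-one-point :
      ∀ {k} → blocks S k → ∃! _≡_ λ x → x ∈ points S × x ∉ k

record Inscribed {m} (S T : Part m) : Set where
  field
    point-on-one-block :
      ∀ {x} → x ∈ points S → ∃! _≡_ λ k → blocks T k × x ∈ k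
    block-through-one-point :
      ∀ {k} → blocks S k → ∃! _≡_ λ x → x ∈ points T × x ∈ k

record IsDecomposition {n} (φ : Permutation′ n) (S₁ S₂ : Part (n + n)) : Set where
  field
    points-size₁    : ∣ points S₁ ∣ ≡ n
    points-size₂    : ∣ points S₂ ∣ ≡ n
    points-disjoint : points S₁ ∩ points S₂ ≡ ⊥
    points-cover    : points S₁ ∪ points S₂ ≡ ⊤
    blocks-size₁    : HasSize (blocks S₁) n
    blocks-size₂    : HasSize (blocks S₂) n
    blocks-disjoint : blocks S₁ U.⊥ blocks S₂
    blocks-cover    : blocks S₁ U.∪ blocks S₂ U.≐ Block (𝔐 n φ)
    simplex₁        : IsSimplex S₁
    simplex₂        : IsSimplex S₂
    inscribed₁₂     : Inscribed S₁ S₂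
    inscribed₂₁     : Inscribed S₂ S₁

Nonstandard : ∀ {n} → Permutation′ n → Part (n + n) → Set
Nonstandard φ S = ¬ (S ≈ S-A φ) × ¬ (S ≈ S-B φ)

record SpecialDecomposition {n} (φ : Permutation′ n) : Set₁ where
  field
    S₁ S₂           : Part (n + n)
    isDecomposition : IsDecomposition φ S₁ S₂
    nonstandard₁    : Nonstandard φ S₁
    nonstandard₂    : Nonstandard φ S₂

  parts : Part (n + n) × Part (n + n)
  parts = S₁ , S₂

open SpecialDecomposition public using (parts)

infix 4 _≈ᵘ_ _≈ᵈ_ _≉ᵈ_

-- Equality of unordered pairs.
_≈ᵘ_ : ∀ {m} → Part m × Part m → Part m × Part m → Set
(S₁ , S₂) ≈ᵘ (T₁ , T₂) = (S₁ ≈ T₁ × S₂ ≈ T₂) ⊎ (S₁ ≈ T₂ × S₂ ≈ T₁)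

_≈ᵈ_ _≉ᵈ_ : ∀ {n} {φ : Permutation′ n} → (D E : SpecialDecomposition φ) → Set
D ≈ᵈ E = parts D ≈ᵘ parts E
D ≉ᵈ E = ¬ (D ≈ᵈ E)

associatedPart : Permutation′ 4 → Subset 4 → Part (4 + 4)
associatedPart φ X = ⟪ X ++ ∁ X , blocksOf ⟫
  where
  blocksOf : Family (4 + 4)
  blocksOf k = (∃[ i ] i ∈ X × k ≡ blockB φ i) ⊎ (∃[ j ] j ∉ X × k ≡ blockA φ j)

remainingPart : Permutation′ 4 → Part (4 + 4) → Part (4 + 4)
remainingPart φ S = ⟪ ∁ (points S) , Block (𝔐 4 φ) U.∩ U.∁ (blocks S) ⟫

record AssociatedWith {φ : Permutation′ 4}
                      (X : Subset 4) (D : SpecialDecomposition φ) : Set where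
  field
    size-two   : ∣ X ∣ ≡ 2
    invariant  : image φ X ≡ X
    parts-of-X : let S = associatedPart φ X in parts D ≈ᵘ (S , remainingPart φ S)

UniqueSpecial : Permutation′ 4 → Subset 4 → Set₁
UniqueSpecial φ X = Σ[ D ∈ SpecialDecomposition φ ]
  AssociatedWith X D × (∀ E → E ≈ᵈ D)

ThreeSpecial : Permutation′ 4 → Subset 4 → Subset 4 → Subset 4 → Set₁
ThreeSpecial φ X Y Z =
  Σ[ D ∈ SpecialDecomposition φ ]
  Σ[ E ∈ SpecialDecomposition φ ]
  Σ[ F ∈ SpecialDecomposition φ ]
    (AssociatedWith X D × AssociatedWith Y E × AssociatedWith Z F)
  × (D ≉ᵈ E × D ≉ᵈ F × E ≉ᵈ F)
  × (∀ G → G ≈ᵈ D ⊎ G ≈ᵈ E ⊎ G ≈ᵈ F)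

-- The elements of I = {1,2,3,4}.
pattern one   = Fin.zero
pattern two   = Fin.suc one
pattern three = Fin.suc two
pattern four  = Fin.suc three

⁅_,_⁆ : ∀ {n} → Fin n → Fin n → Subset n
⁅ i , j ⁆ = ⁅ i ⁆ ∪ ⁅ j ⁆

⟨13⟩⟨24⟩ ⟨12⟩ : Permutation′ 4
⟨13⟩⟨24⟩ = transpose one three ∘ₚ transpose two four
⟨12⟩     = transpose one two

{-# OPTIONS --safe #-}

-- Write the points of one simplex of a decomposition as X ++ Y, with X and Y
-- the index sets of its aᵢ and bᵢ, so that the other simplex has points
-- ∁ X ++ ∁ Y.  That a block misses exactly one point of its own simplex reads
--   Aᵢ:  ∣Y∣ + [i ∈ X] = 1 + [i ∈ Y],    Bᵢ:  ∣X∣ + [i ∈ Y] = 1 + [φ i ∈ X]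
-- in the first simplex, and the same with complements in the second.  Since
-- ∣X∣ + ∣Y∣ = n, we may take ∣Y∣ ≤ ∣X∣ by swapping the two simplices.  If
-- ∣X∣ ≥ 3 then every Aᵢ lies in the first simplex and every Bᵢ in the second,
-- and this forces Y = ∅, the standard decomposition.  Otherwise
-- ∣X∣ = ∣Y∣ = 2 and n = 4, and the equations determine the rest: Y = ∁ X,
-- φ X = X, and the blocks of the first simplex are Bᵢ (i ∈ X), Aⱼ (j ∉ X).
--
-- Conjugating φ gives an isomorphic pair.  The three pairs are told apart by
-- which blocks have a block as their complement: all of them for id, none for
-- (13)(24), and some but not all for (12).
module Submission where

open import Defs
open import Data.Bool using (true; false; not; if_then_else_) renaming (_≟_ to _≟ᵇ_)
open import Data.Bool.Properties using (not-involutive)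
open import Data.Empty using (⊥-elim)
open import Data.Fin using (Fin; zero; suc; fromℕ<; _↑ˡ_; _↑ʳ_; splitAt)
open import Data.Fin.Permutation
  using (Permutation; Permutation′; _⟨$⟩ʳ_; _⟨$⟩ˡ_; inverseˡ; inverseʳ; flip; transpose; _∘ₚ_)
  renaming (id to idₚ)
open import Data.Fin.Properties using (_≟_; any?; all?; +↔⊎)
open import Data.Fin.Subset renaming (⁅_⁆ to ｛_｝)
open import Data.Fin.Subset.Properties
open import Data.Nat using (ℕ; zero; suc; _+_; _≤_; s≤s; z≤n; s≤s⁻¹)
open import Data.Nat.Properties renaming (_≟_ to _≟ℕ_)
open import Data.Product using (∃-syntax; ∃!; _×_; _,_; proj₁; proj₂)
open import Data.Sum as Sum using (_⊎_; inj₁; inj₂; [_,_]′; swap)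
open import Data.Sum.Function.Propositional using (_⊎-↔_)
open import Data.Vec using ([]; _∷_; _++_; lookup; tabulate; take; drop; here; there)
open import Data.Vec.Properties
open import Function using (_⇔_; mk⇔; Equivalence; _∘_)
open import Function.Construct.Composition using (_↔-∘_)
open import Function.Construct.Symmetry using (↔-sym)
open import Relation.Binary.PropositionalEquality
open import Relation.Nullary using (¬_; Dec; yes; no; contradiction)
open import Relation.Nullary.Decidable
open import Relation.Unary as U using ()

private
  variable
    m n : ℕ

-- Subsets as Boolean vectors.

lookup-ext : ∀ {p q : Subset n} → (∀ i → lookup p i ≡ lookup q i) → p ≡ q
lookup-ext {p = p} {q} eq =
  trans (sym (tabulate∘lookup p)) (trans (tabulate-cong eq) (tabulate∘lookup q))

∈⇒true : ∀ {p : Subset n} {i} → i ∈ p → lookup p i ≡ true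
∈⇒true = []=⇒lookup

∉⇒false : ∀ {p : Subset n} {i} → i ∉ p → lookup p i ≡ false
∉⇒false {p = p} {i} i∉p with lookup p i in eq
... | true  = contradiction (lookup⇒[]= i p eq) i∉p
... | false = refl

true⇒∈ : ∀ {p : Subset n} {i} → lookup p i ≡ true → i ∈ p
true⇒∈ = lookup⇒[]= _ _

false⇒∉ : ∀ {p : Subset n} {i} → lookup p i ≡ false → i ∉ p
false⇒∉ eq i∈p with trans (sym eq) (∈⇒true i∈p)
... | ()

∈-tabulate⁺ : ∀ {f : Fin n → Side} {i} → f i ≡ true → i ∈ tabulate f
∈-tabulate⁺ {f = f} {i} eq = true⇒∈ (trans (lookup∘tabulate f i) eq)

∈-tabulate⁻ : ∀ {f : Fin n → Side} {i} → i ∈ tabulate f → f i ≡ true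
∈-tabulate⁻ {f = f} {i} i∈ = trans (sym (lookup∘tabulate f i)) (∈⇒true i∈)

∁-involutive : ∀ (p : Subset n) → ∁ (∁ p) ≡ p
∁-involutive []      = refl
∁-involutive (x ∷ p) = cong₂ _∷_ (not-involutive x) (∁-involutive p)

lookup-∁ : ∀ (p : Subset n) i → lookup (∁ p) i ≡ not (lookup p i)
lookup-∁ p i = lookup-map i not p

∩∪⇒∁ : ∀ {p q : Subset n} → p ∩ q ≡ ⊥ → p ∪ q ≡ ⊤ → q ≡ ∁ p
∩∪⇒∁ {p = []}        {[]}        _  _  = refl
∩∪⇒∁ {p = true ∷ p}  {false ∷ q} eq eq′ = cong (false ∷_) (∩∪⇒∁ (∷-injectiveʳ eq) (∷-injectiveʳ eq′))
∩∪⇒∁ {p = false ∷ p} {true ∷ q}  eq eq′ = cong (true ∷_) (∩∪⇒∁ (∷-injectiveʳ eq) (∷-injectiveʳ eq′))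

-- Blocks split into their `a`-half and their `b`-half.

⁅↑ˡ⁆ : ∀ (i : Fin m) → ｛ i ↑ˡ n ｝ ≡ ｛ i ｝ ++ ⊥
⁅↑ˡ⁆ {suc m} {n} zero    = cong (true ∷_) (⊥-++ m)
  where
  ⊥-++ : ∀ m → ⊥ {m + n} ≡ ⊥ {m} ++ ⊥
  ⊥-++ zero    = refl
  ⊥-++ (suc m) = cong (false ∷_) (⊥-++ m)
⁅↑ˡ⁆ (suc i) = cong (false ∷_) (⁅↑ˡ⁆ i)

⁅↑ʳ⁆ : ∀ m (i : Fin n) → ｛ m ↑ʳ i ｝ ≡ ⊥ {m} ++ ｛ i ｝
⁅↑ʳ⁆ zero    i = refl
⁅↑ʳ⁆ (suc m) i = cong (false ∷_) (⁅↑ʳ⁆ m i)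

⊤-⁅i⁆ : ∀ (i : Fin n) → ⊤ ─ ｛ i ｝ ≡ ∁ ｛ i ｝
⊤-⁅i⁆ {suc n} zero    = cong (false ∷_) (trans (p─⊥≡p ⊤) (sym (map-replicate not false n)))
⊤-⁅i⁆ {suc n} (suc i) = cong (true ∷_) (⊤-⁅i⁆ i)

-- Each half of a block is a singleton or the complement of one, so every later count on a half is a
-- count at a single index.
blockA≡ : ∀ (φ : Permutation′ n) i → blockA φ i ≡ ∁ ｛ i ｝ ++ ｛ i ｝
blockA≡ {n} φ i = begin
  (A n ─ ｛ a i ｝) ∪ ｛ b i ｝
    ≡⟨ cong₂ (λ r s → (A n ─ r) ∪ s) (⁅↑ˡ⁆ i) (⁅↑ʳ⁆ n i) ⟩
  (A n ─ (｛ i ｝ ++ ⊥)) ∪ (⊥ {n} ++ ｛ i ｝)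
    ≡⟨ cong (_∪ (⊥ {n} ++ ｛ i ｝)) (zipWith-++ _ (⊤ {n}) ⊥ ｛ i ｝ ⊥) ⟩
  ((⊤ ─ ｛ i ｝) ++ (⊥ ─ ⊥)) ∪ (⊥ {n} ++ ｛ i ｝)
    ≡⟨ zipWith-++ _ (⊤ ─ ｛ i ｝) (⊥ ─ ⊥) ⊥ ｛ i ｝ ⟩
  ((⊤ ─ ｛ i ｝) ∪ ⊥) ++ ((⊥ ─ ⊥) ∪ ｛ i ｝)
    ≡⟨ cong₂ _++_ (trans (∪-identityʳ _) (⊤-⁅i⁆ i))
                  (trans (cong (_∪ ｛ i ｝) (p─⊥≡p ⊥)) (∪-identityˡ _)) ⟩
  ∁ ｛ i ｝ ++ ｛ i ｝ ∎
  where open ≡-Reasoning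

blockB≡ : ∀ (φ : Permutation′ n) i → blockB φ i ≡ ｛ φ ⟨$⟩ʳ i ｝ ++ ∁ ｛ i ｝
blockB≡ {n} φ i = begin
  (B n ─ ｛ b i ｝) ∪ ｛ a j ｝
    ≡⟨ cong₂ (λ r s → (B n ─ r) ∪ s) (⁅↑ʳ⁆ n i) (⁅↑ˡ⁆ j) ⟩
  (B n ─ (⊥ {n} ++ ｛ i ｝)) ∪ (｛ j ｝ ++ ⊥)
    ≡⟨ cong (_∪ (｛ j ｝ ++ ⊥)) (zipWith-++ _ (⊥ {n}) ⊤ ⊥ ｛ i ｝) ⟩
  ((⊥ ─ ⊥) ++ (⊤ ─ ｛ i ｝)) ∪ (｛ j ｝ ++ ⊥)
    ≡⟨ zipWith-++ _ (⊥ ─ ⊥) (⊤ ─ ｛ i ｝) ｛ j ｝ ⊥ ⟩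
  ((⊥ ─ ⊥) ∪ ｛ j ｝) ++ ((⊤ ─ ｛ i ｝) ∪ ⊥)
    ≡⟨ cong₂ _++_ (trans (cong (_∪ ｛ j ｝) (p─⊥≡p ⊥)) (∪-identityˡ _))
                  (trans (∪-identityʳ _) (⊤-⁅i⁆ i)) ⟩
  ｛ j ｝ ++ ∁ ｛ i ｝ ∎
  where
  open ≡-Reasoning
  j = φ ⟨$⟩ʳ i

-- Counting the points of a part that a block misses.

-- The Iverson bracket: δ (lookup X i) is [i ∈ X].
δ : Side → ℕ
δ true  = 1
δ false = 0

∣p++q∣≡∣p∣+∣q∣ : ∀ (p : Subset m) (q : Subset n) → ∣ p ++ q ∣ ≡ ∣ p ∣ + ∣ q ∣
∣p++q∣≡∣p∣+∣q∣ []          q = refl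
∣p++q∣≡∣p∣+∣q∣ (true ∷ p)  q = cong suc (∣p++q∣≡∣p∣+∣q∣ p q)
∣p++q∣≡∣p∣+∣q∣ (false ∷ p) q = ∣p++q∣≡∣p∣+∣q∣ p q

∣p∣+∣∁p∣≡n : ∀ (p : Subset n) → ∣ p ∣ + ∣ ∁ p ∣ ≡ n
∣p∣+∣∁p∣≡n {n} p = trans (cong (∣ p ∣ +_) (∣∁p∣≡n∸∣p∣ p)) (m+[n∸m]≡n (∣p∣≤n p))

∣p∣≡0⇒p≡⊥ : ∀ {p : Subset n} → ∣ p ∣ ≡ 0 → p ≡ ⊥
∣p∣≡0⇒p≡⊥ {p = []}        _  = refl
∣p∣≡0⇒p≡⊥ {p = false ∷ p} eq = cong (false ∷_) (∣p∣≡0⇒p≡⊥ eq)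

∣p∩⁅i⁆∣ : ∀ (p : Subset n) i → ∣ p ∩ ｛ i ｝ ∣ ≡ δ (lookup p i)
∣p∩⁅i⁆∣ {suc n} (true ∷ p)  zero = cong suc (trans (cong ∣_∣ (∩-zeroʳ p)) (∣⊥∣≡0 n))
∣p∩⁅i⁆∣ {suc n} (false ∷ p) zero = trans (cong ∣_∣ (∩-zeroʳ p)) (∣⊥∣≡0 n)
∣p∩⁅i⁆∣ (true ∷ p)  (suc i) = ∣p∩⁅i⁆∣ p i
∣p∩⁅i⁆∣ (false ∷ p) (suc i) = ∣p∩⁅i⁆∣ p i

∣p∩∁⁅i⁆∣ : ∀ (p : Subset n) i → ∣ p ∩ ∁ ｛ i ｝ ∣ + δ (lookup p i) ≡ ∣ p ∣
∣p∩∁⁅i⁆∣ {suc n} (x ∷ p) zero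
  rewrite map-replicate not false n | ∩-identityʳ p with x
... | true  = +-comm ∣ p ∣ 1
... | false = +-identityʳ ∣ p ∣
∣p∩∁⁅i⁆∣ (true ∷ p)  (suc i) = cong suc (∣p∩∁⁅i⁆∣ p i)
∣p∩∁⁅i⁆∣ (false ∷ p) (suc i) = ∣p∩∁⁅i⁆∣ p i

-- Turns the unique existence of the definitions into an equation between numbers; the converse
-- below serves the finite checks.
∃!⇒∣p∣≡1 : ∀ {p : Subset n} → ∃! _≡_ (_∈ p) → ∣ p ∣ ≡ 1
∃!⇒∣p∣≡1 {p = p} (x , x∈p , unique) = trans (cong ∣_∣ p≡⁅x⁆) (∣⁅x⁆∣≡1 x)
  where
  p≡⁅x⁆ : p ≡ ｛ x ｝
  p≡⁅x⁆ = ⊆-antisym (λ y∈p → subst (_∈ ｛ x ｝) (unique y∈p) (x∈⁅x⁆ x))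
                    (λ y∈⁅x⁆ → subst (_∈ p) (sym (x∈⁅y⁆⇒x≡y x y∈⁅x⁆)) x∈p)

∣p∣≡1⇒∃! : ∀ {p : Subset n} → ∣ p ∣ ≡ 1 → ∃! _≡_ (_∈ p)
∣p∣≡1⇒∃! {p = true ∷ p} eq = zero , here , unique
  where
  unique : ∀ {y} → y ∈ true ∷ p → zero ≡ y
  unique here        = refl
  unique (there y∈p) = contradiction (subst (_ ∈_) (∣p∣≡0⇒p≡⊥ (suc-injective eq)) y∈p) ∉⊥
∣p∣≡1⇒∃! {p = false ∷ p} eq with ∣p∣≡1⇒∃! eq
... | x , x∈p , unique = suc x , there x∈p , λ { (there y∈p) → cong suc (unique y∈p) }

∃!-map : ∀ {X : Set} {P Q : X → Set} → (∀ {x} → P x → Q x) → (∀ {x} → Q x → P x) →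
         ∃! _≡_ P → ∃! _≡_ Q
∃!-map f g (x , px , unique) = x , f px , λ qy → unique (g qy)

module _ (X Y : Subset n) (φ : Permutation′ n) (i : Fin n) where

  private
    -- The points of `X ++ Y` off `k` form an intersection with `∁ k`, which is counted half by
    -- half.
    missed : ∀ {k} → ∃! _≡_ (λ x → x ∈ X ++ Y × x ∉ k) → ∀ r s → k ≡ r ++ s →
             ∣ X ∩ ∁ r ∣ + ∣ Y ∩ ∁ s ∣ ≡ 1
    missed {k} u r s refl = begin
      ∣ X ∩ ∁ r ∣ + ∣ Y ∩ ∁ s ∣        ≡⟨ ∣p++q∣≡∣p∣+∣q∣ (X ∩ ∁ r) (Y ∩ ∁ s) ⟨
      ∣ (X ∩ ∁ r) ++ (Y ∩ ∁ s) ∣       ≡⟨ cong ∣_∣ (zipWith-++ _ X Y (∁ r) (∁ s)) ⟨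
      ∣ (X ++ Y) ∩ (∁ r ++ ∁ s) ∣      ≡⟨ cong (λ c → ∣ (X ++ Y) ∩ c ∣) (map-++ not r s) ⟨
      ∣ (X ++ Y) ∩ ∁ (r ++ s) ∣        ≡⟨ ∃!⇒∣p∣≡1 (∃!-map to from u) ⟩
      1                                ∎
      where
      open ≡-Reasoning
      to : ∀ {x} → x ∈ X ++ Y × x ∉ k → x ∈ (X ++ Y) ∩ ∁ k
      to (x∈ , x∉) = x∈p∩q⁺ (x∈ , x∉p⇒x∈∁p x∉)
      from : ∀ {x} → x ∈ (X ++ Y) ∩ ∁ k → x ∈ X ++ Y × x ∉ k
      from x∈ = let x∈₁ , x∈₂ = x∈p∩q⁻ _ _ x∈ in x∈₁ , x∈∁p⇒x∉p x∈₂

  -- The missed points number [i ∈ X] + (∣Y∣ - [i ∈ Y]). Adding [i ∈ Y] to both sides avoids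
  -- truncated subtraction.
  blockA-misses-one : ∃! _≡_ (λ x → x ∈ X ++ Y × x ∉ blockA φ i) →
                      ∣ Y ∣ + δ (lookup X i) ≡ suc (δ (lookup Y i))
  blockA-misses-one u = begin
    ∣ Y ∣ + x                                    ≡⟨ cong (_+ x) (∣p∩∁⁅i⁆∣ Y i) ⟨
    (∣ Y ∩ ∁ ｛ i ｝ ∣ + y) + x                    ≡⟨ +-comm _ x ⟩
    x + (∣ Y ∩ ∁ ｛ i ｝ ∣ + y)                    ≡⟨ +-assoc x _ y ⟨
    x + ∣ Y ∩ ∁ ｛ i ｝ ∣ + y                      ≡⟨ cong (λ c → c + ∣ Y ∩ ∁ ｛ i ｝ ∣ + y) (∣p∩⁅i⁆∣ X i) ⟨
    ∣ X ∩ ｛ i ｝ ∣ + ∣ Y ∩ ∁ ｛ i ｝ ∣ + y          ≡⟨ cong (λ r → ∣ X ∩ r ∣ + ∣ Y ∩ ∁ ｛ i ｝ ∣ + y) (∁-involutive ｛ i ｝) ⟨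
    ∣ X ∩ ∁ (∁ ｛ i ｝) ∣ + ∣ Y ∩ ∁ ｛ i ｝ ∣ + y    ≡⟨ cong (_+ y) (missed u (∁ ｛ i ｝) ｛ i ｝ (blockA≡ φ i)) ⟩
    suc y                                        ∎
    where
    open ≡-Reasoning
    x = δ (lookup X i)
    y = δ (lookup Y i)

  blockB-misses-one : ∃! _≡_ (λ x → x ∈ X ++ Y × x ∉ blockB φ i) →
                      ∣ X ∣ + δ (lookup Y i) ≡ suc (δ (lookup X (φ ⟨$⟩ʳ i)))
  blockB-misses-one u = begin
    ∣ X ∣ + y                                    ≡⟨ cong (_+ y) (∣p∩∁⁅i⁆∣ X j) ⟨
    (∣ X ∩ ∁ ｛ j ｝ ∣ + x) + y                    ≡⟨ +-assoc _ x y ⟩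
    ∣ X ∩ ∁ ｛ j ｝ ∣ + (x + y)                    ≡⟨ cong (∣ X ∩ ∁ ｛ j ｝ ∣ +_) (+-comm x y) ⟩
    ∣ X ∩ ∁ ｛ j ｝ ∣ + (y + x)                    ≡⟨ +-assoc _ y x ⟨
    ∣ X ∩ ∁ ｛ j ｝ ∣ + y + x                      ≡⟨ cong (λ c → ∣ X ∩ ∁ ｛ j ｝ ∣ + c + x) (∣p∩⁅i⁆∣ Y i) ⟨
    ∣ X ∩ ∁ ｛ j ｝ ∣ + ∣ Y ∩ ｛ i ｝ ∣ + x          ≡⟨ cong (λ r → ∣ X ∩ ∁ ｛ j ｝ ∣ + ∣ Y ∩ r ∣ + x) (∁-involutive ｛ i ｝) ⟨
    ∣ X ∩ ∁ ｛ j ｝ ∣ + ∣ Y ∩ ∁ (∁ ｛ i ｝) ∣ + x    ≡⟨ cong (_+ x) (missed u ｛ j ｝ (∁ ｛ i ｝) (blockB≡ φ i)) ⟩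
    suc x                                        ∎
    where
    open ≡-Reasoning
    j = φ ⟨$⟩ʳ i
    x = δ (lookup X j)
    y = δ (lookup Y i)

-- The shape of a special decomposition.

-- The membership fields place each Aᵢ and each Bᵢ; together with `disjoint` and `cover` they
-- determine both block families from `X`.
record Crossing (φ : Permutation′ n) (X : Subset n) (S₁ S₂ : Part (n + n)) : Set where
  field
    points₁   : points S₁ ≡ X ++ ∁ X
    points₂   : points S₂ ≡ ∁ X ++ X
    size      : ∣ X ∣ ≡ 2
    co-size   : ∣ ∁ X ∣ ≡ 2
    invariant : ∀ i → lookup X (φ ⟨$⟩ʳ i) ≡ lookup X i
    blocks-∈  : ∀ {i} → i ∈ X → blocks S₁ (blockB φ i) × blocks S₂ (blockA φ i)
    blocks-∉  : ∀ {i} → i ∉ X → blocks S₁ (blockA φ i) × blocks S₂ (blockB φ i)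
    disjoint  : blocks S₁ U.⊥ blocks S₂
    cover     : blocks S₁ U.∪ blocks S₂ U.≐ Block (𝔐 n φ)

-- The conditions are symmetric under exchanging the parts and complementing `X`, so `X` matters
-- only up to complement.
Crossing-swap : ∀ {φ : Permutation′ n} {X S₁ S₂} →
                Crossing φ X S₁ S₂ → Crossing φ (∁ X) S₂ S₁
Crossing-swap {X = X} C = record
  { points₁   = trans points₂ (cong (∁ X ++_) (sym (∁-involutive X)))
  ; points₂   = trans points₁ (cong (_++ ∁ X) (sym (∁-involutive X)))
  ; size      = co-size
  ; co-size   = trans (cong ∣_∣ (∁-involutive X)) size
  ; invariant = λ i → trans (lookup-∁ X _) (trans (cong not (invariant i)) (sym (lookup-∁ X i)))
  ; blocks-∈  = λ i∈∁X → let k₁ , k₂ = blocks-∉ (x∈∁p⇒x∉p i∈∁X) in k₂ , k₁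
  ; blocks-∉  = λ i∉∁X → let k₁ , k₂ = blocks-∈ (x∉∁p⇒x∈p i∉∁X) in k₂ , k₁
  ; disjoint  = λ (k₂ , k₁) → disjoint (k₁ , k₂)
  ; cover     = (λ k → proj₁ cover (swap k)) , (λ k → swap (proj₂ cover k))
  }
  where open Crossing C

IsDecomposition-swap : ∀ {φ : Permutation′ n} {S₁ S₂} →
                       IsDecomposition φ S₁ S₂ → IsDecomposition φ S₂ S₁
IsDecomposition-swap D = record
  { points-size₁    = points-size₂
  ; points-size₂    = points-size₁
  ; points-disjoint = trans (∩-comm _ _) points-disjoint
  ; points-cover    = trans (∪-comm _ _) points-cover
  ; blocks-size₁    = blocks-size₂
  ; blocks-size₂    = blocks-size₁
  ; blocks-disjoint = λ (k₂ , k₁) → blocks-disjoint (k₁ , k₂)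
  ; blocks-cover    = (λ k → proj₁ blocks-cover (swap k)) , (λ k → swap (proj₂ blocks-cover k))
  ; simplex₁        = simplex₂
  ; simplex₂        = simplex₁
  ; inscribed₁₂     = inscribed₂₁
  ; inscribed₂₁     = inscribed₁₂
  }
  where open IsDecomposition D

resize : ∀ {k l s t : ℕ} → k ≡ l → k + s ≡ t → l + s ≡ t
resize refl eq = eq

δ-injective : ∀ {x y} → δ x ≡ δ y → x ≡ y
δ-injective {true}  {true}  _ = refl
δ-injective {false} {false} _ = refl

-- The left side is at least 3, the right side at most 2.
too-large : ∀ {k} {x y} → 3 ≤ k → ¬ k + δ x ≡ suc (δ y)
too-large {x = x} {y} 3≤k eq = <⇒≱ (≤-trans 3≤k (≤-trans (m≤m+n _ (δ x)) (≤-reflexive eq))) (s≤s (δ≤1 y))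
  where
  δ≤1 : ∀ y → δ y ≤ 1
  δ≤1 true  = ≤-refl
  δ≤1 false = z≤n

-- The left side is at least 2 and the right side at most 2, so both are 2.
2+δ≡1+δ : ∀ {x y} → 2 + δ x ≡ suc (δ y) → x ≡ false × y ≡ true
2+δ≡1+δ {false} {true} _ = refl , refl

module _ {φ : Permutation′ n} {S₁ S₂} (D : IsDecomposition φ S₁ S₂) (4≤n : 4 ≤ n)
         (X Y : Subset n) (P₁≡ : points S₁ ≡ X ++ Y) (∣Y∣≤∣X∣ : ∣ Y ∣ ≤ ∣ X ∣) where

  open IsDecomposition D

  private
    P₂≡ : points S₂ ≡ ∁ X ++ ∁ Y
    P₂≡ = trans (∩∪⇒∁ points-disjoint points-cover) (trans (cong ∁ P₁≡) (map-++ not X Y))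

    ∣X∣+∣Y∣≡n : ∣ X ∣ + ∣ Y ∣ ≡ n
    ∣X∣+∣Y∣≡n = trans (sym (∣p++q∣≡∣p∣+∣q∣ X Y)) (trans (cong ∣_∣ (sym P₁≡)) points-size₁)

    ∣∁X∣≡∣Y∣ : ∣ ∁ X ∣ ≡ ∣ Y ∣
    ∣∁X∣≡∣Y∣ = +-cancelˡ-≡ ∣ X ∣ _ _ (trans (∣p∣+∣∁p∣≡n X) (sym ∣X∣+∣Y∣≡n))

    ∣∁Y∣≡∣X∣ : ∣ ∁ Y ∣ ≡ ∣ X ∣
    ∣∁Y∣≡∣X∣ = +-cancelˡ-≡ ∣ Y ∣ _ _
      (trans (∣p∣+∣∁p∣≡n Y) (trans (sym ∣X∣+∣Y∣≡n) (+-comm ∣ X ∣ ∣ Y ∣)))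

    A₁ : ∀ {i} → blocks S₁ (blockA φ i) → ∣ Y ∣ + δ (lookup X i) ≡ suc (δ (lookup Y i))
    A₁ {i} k = blockA-misses-one X Y φ i
      (subst (λ P → ∃! _≡_ λ x → x ∈ P × x ∉ _) P₁≡ (IsSimplex.block-misses-one-point simplex₁ k))

    B₁ : ∀ {i} → blocks S₁ (blockB φ i) →
         ∣ X ∣ + δ (lookup Y i) ≡ suc (δ (lookup X (φ ⟨$⟩ʳ i)))
    B₁ {i} k = blockB-misses-one X Y φ i
      (subst (λ P → ∃! _≡_ λ x → x ∈ P × x ∉ _) P₁≡ (IsSimplex.block-misses-one-point simplex₁ k))

    -- Sizes of complements are replaced by ∣X∣ and ∣Y∣, so that one bound on ∣X∣ excludes Aᵢ from
    -- the second part and Bᵢ from the first.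
    A₂ : ∀ {i} → blocks S₂ (blockA φ i) → ∣ X ∣ + δ (lookup (∁ X) i) ≡ suc (δ (lookup (∁ Y) i))
    A₂ {i} k = resize ∣∁Y∣≡∣X∣ (blockA-misses-one (∁ X) (∁ Y) φ i
      (subst (λ P → ∃! _≡_ λ x → x ∈ P × x ∉ _) P₂≡ (IsSimplex.block-misses-one-point simplex₂ k)))

    B₂ : ∀ {i} → blocks S₂ (blockB φ i) →
         ∣ Y ∣ + δ (lookup (∁ Y) i) ≡ suc (δ (lookup (∁ X) (φ ⟨$⟩ʳ i)))
    B₂ {i} k = resize ∣∁X∣≡∣Y∣ (blockB-misses-one (∁ X) (∁ Y) φ i
      (subst (λ P → ∃! _≡_ λ x → x ∈ P × x ∉ _) P₂≡ (IsSimplex.block-misses-one-point simplex₂ k)))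

    A-side : ∀ i → blocks S₁ (blockA φ i) ⊎ blocks S₂ (blockA φ i)
    A-side i = proj₂ blocks-cover (inj₁ (i , refl))

    B-side : ∀ i → blocks S₁ (blockB φ i) ⊎ blocks S₂ (blockB φ i)
    B-side i = proj₂ blocks-cover (inj₂ (i , refl))

  large⇒standard : 3 ≤ ∣ X ∣ → S₁ ≈ S-A φ
  large⇒standard 3≤∣X∣ = standard ∣ Y ∣ refl
    where
    A∈₁ : ∀ i → blocks S₁ (blockA φ i)
    A∈₁ i with A-side i
    ... | inj₁ k = k
    ... | inj₂ k = contradiction (A₂ k) (too-large {x = lookup (∁ X) i} 3≤∣X∣)

    B∈₂ : ∀ i → blocks S₂ (blockB φ i)
    B∈₂ i with B-side i
    ... | inj₁ k = contradiction (B₁ k) (too-large {x = lookup Y i} 3≤∣X∣)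
    ... | inj₂ k = k

    blocks≐ : blocks S₁ U.≐ ℒA φ
    blocks≐ = to , λ { (i , refl) → A∈₁ i }
      where
      to : ∀ {k} → blocks S₁ k → ℒA φ k
      to k₁ with proj₁ blocks-cover (inj₁ k₁)
      ... | inj₁ k∈A        = k∈A
      -- A Bᵢ in the first part would lie in both parts.
      ... | inj₂ (i , refl) = ⊥-elim (blocks-disjoint (k₁ , B∈₂ i))

    -- Now ∣Y∣ + [i ∈ X] = 1 + [i ∈ Y] holds for every `i`; with the bounds on ∣X∣ and `n` it
    -- refutes each nonzero ∣Y∣.
    standard : ∀ y → ∣ Y ∣ ≡ y → S₁ ≈ S-A φ
    standard 0 eq = trans P₁≡ (cong₂ _++_ (∣p∣≡n⇒p≡⊤ {p = X} ∣X∣≡n) (∣p∣≡0⇒p≡⊥ {p = Y} eq)) , blocks≐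
      where
      ∣X∣≡n = trans (sym (trans (cong (∣ X ∣ +_) eq) (+-identityʳ ∣ X ∣))) ∣X∣+∣Y∣≡n
    -- The equation reduces to [i ∈ X] = [i ∈ Y], so ∣X∣ = 1.
    standard 1 eq = contradiction (subst (3 ≤_) (trans (cong ∣_∣ X≡Y) eq) 3≤∣X∣) λ { (s≤s ()) }
      where
      X≡Y : X ≡ Y
      X≡Y = lookup-ext λ i → δ-injective
        (suc-injective (resize eq (A₁ (A∈₁ i))))
    -- The equation puts every `i` in `Y`, so `n` would be 2.
    standard 2 eq = contradiction (subst (4 ≤_) (trans (sym (∣⊤∣≡n n)) (trans (cong ∣_∣ (sym Y≡⊤)) eq)) 4≤n)
      λ { (s≤s (s≤s ())) }
      where
      Y≡⊤ : Y ≡ ⊤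
      Y≡⊤ = ⊆-antisym ⊆⊤ λ {i} _ → true⇒∈
        (proj₂ (2+δ≡1+δ {lookup X i} (resize eq (A₁ (A∈₁ i)))))
    standard (suc (suc (suc y))) eq = contradiction (A₁ (A∈₁ i₀))
      (too-large {x = lookup X i₀} (subst (3 ≤_) (sym eq) (s≤s (s≤s (s≤s z≤n)))))
      -- Any index refutes this case; `4≤n` supplies index 0.
      where i₀ = fromℕ< (≤-trans (s≤s z≤n) 4≤n)

  -- The equations become 2 + [·] = 1 + [·], so the part containing a block fixes both brackets in
  -- its equation.
  balanced⇒Crossing : ∣ X ∣ ≡ 2 → ∣ Y ∣ ≡ 2 → Crossing φ X S₁ S₂
  balanced⇒Crossing ∣X∣≡2 ∣Y∣≡2 = record
    { points₁   = trans P₁≡ (cong (X ++_) Y≡∁X)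
    ; points₂   = trans P₂≡ (cong (∁ X ++_) (trans (cong ∁ Y≡∁X) (∁-involutive X)))
    ; size      = ∣X∣≡2
    ; co-size   = trans ∣∁X∣≡∣Y∣ ∣Y∣≡2
    ; invariant = invariant
    ; blocks-∈  = λ {i} i∈X → in-X i∈X (local i)
    ; blocks-∉  = λ {i} i∉X → out-X i∉X (local i)
    ; disjoint  = blocks-disjoint
    ; cover     = blocks-cover
    }
    where
    ∁⁻ : ∀ {s} (p : Subset n) {i} → lookup (∁ p) i ≡ s → lookup p i ≡ not s
    ∁⁻ p {i} eq = trans (cong (λ q → lookup q i) (sym (∁-involutive p)))
                        (trans (lookup-∁ (∁ p) i) (cong not eq))

    A₁′ : ∀ {i} → blocks S₁ (blockA φ i) → lookup X i ≡ false × lookup Y i ≡ true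
    A₁′ {i} k = 2+δ≡1+δ (resize ∣Y∣≡2 (A₁ k))

    A₂′ : ∀ {i} → blocks S₂ (blockA φ i) → lookup X i ≡ true × lookup Y i ≡ false
    A₂′ {i} k = let x , y = 2+δ≡1+δ (resize ∣X∣≡2 (A₂ k)) in ∁⁻ X x , ∁⁻ Y y

    B₁′ : ∀ {i} → blocks S₁ (blockB φ i) → lookup Y i ≡ false × lookup X (φ ⟨$⟩ʳ i) ≡ true
    B₁′ {i} k = 2+δ≡1+δ (resize ∣X∣≡2 (B₁ k))

    B₂′ : ∀ {i} → blocks S₂ (blockB φ i) → lookup Y i ≡ true × lookup X (φ ⟨$⟩ʳ i) ≡ false
    B₂′ {i} k = let y , x = 2+δ≡1+δ (resize ∣Y∣≡2 (B₂ k)) in ∁⁻ Y y , ∁⁻ X x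

    In Out : Fin n → Set
    In i  = (lookup X i ≡ true × lookup Y i ≡ false × lookup X (φ ⟨$⟩ʳ i) ≡ true)
          × blocks S₁ (blockB φ i) × blocks S₂ (blockA φ i)
    Out i = (lookup X i ≡ false × lookup Y i ≡ true × lookup X (φ ⟨$⟩ʳ i) ≡ false)
          × blocks S₁ (blockA φ i) × blocks S₂ (blockB φ i)

    -- Aᵢ and Bᵢ in the same part would give [i ∈ Y] two different values, so the parts separate
    -- them.
    local : ∀ i → In i ⊎ Out i
    local i with A-side i | B-side i
    ... | inj₂ k | inj₁ l = inj₁ ((proj₁ (A₂′ k) , proj₂ (A₂′ k) , proj₂ (B₁′ l)) , l , k)
    ... | inj₁ k | inj₂ l = inj₂ ((proj₁ (A₁′ k) , proj₂ (A₁′ k) , proj₂ (B₂′ l)) , k , l)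
    ... | inj₁ k | inj₁ l with trans (sym (proj₂ (A₁′ k))) (proj₁ (B₁′ l))
    ...   | ()
    local i | inj₂ k | inj₂ l with trans (sym (proj₂ (A₂′ k))) (proj₁ (B₂′ l))
    ...   | ()

    Y≡∁X : Y ≡ ∁ X
    Y≡∁X = lookup-ext λ i → trans (eq i) (sym (lookup-∁ X i))
      where
      eq : ∀ i → lookup Y i ≡ not (lookup X i)
      eq i with local i
      ... | inj₁ ((x , y , _) , _) = trans y (cong not (sym x))
      ... | inj₂ ((x , y , _) , _) = trans y (cong not (sym x))

    invariant : ∀ i → lookup X (φ ⟨$⟩ʳ i) ≡ lookup X i
    invariant i with local i
    ... | inj₁ ((x , _ , x′) , _) = trans x′ (sym x)
    ... | inj₂ ((x , _ , x′) , _) = trans x′ (sym x)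

    in-X : ∀ {i} → i ∈ X → In i ⊎ Out i → blocks S₁ (blockB φ i) × blocks S₂ (blockA φ i)
    in-X i∈X (inj₁ (_ , ks))       = ks
    in-X i∈X (inj₂ ((x , _) , _)) = contradiction i∈X (false⇒∉ x)

    out-X : ∀ {i} → i ∉ X → In i ⊎ Out i → blocks S₁ (blockA φ i) × blocks S₂ (blockB φ i)
    out-X i∉X (inj₁ ((x , _) , _)) = contradiction (true⇒∈ x) i∉X
    out-X i∉X (inj₂ (_ , ks))       = ks

  -- ∣Y∣ ≤ ∣X∣ ≤ 2 and ∣X∣ + ∣Y∣ = n ≥ 4 leave only ∣X∣ = ∣Y∣ = 2.
  nonstandard⇒Crossing : ¬ (S₁ ≈ S-A φ) → Crossing φ X S₁ S₂
  nonstandard⇒Crossing S₁≉ = balanced⇒Crossing ∣X∣≡2 ∣Y∣≡2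
    where
    ∣X∣≤2 : ∣ X ∣ ≤ 2
    ∣X∣≤2 = s≤s⁻¹ (≰⇒> (S₁≉ ∘ large⇒standard))
    2≤∣Y∣ : 2 ≤ ∣ Y ∣
    2≤∣Y∣ = +-cancelˡ-≤ 2 2 _ (≤-trans (subst (4 ≤_) (sym ∣X∣+∣Y∣≡n) 4≤n) (+-monoˡ-≤ ∣ Y ∣ ∣X∣≤2))
    ∣X∣≡2 = ≤-antisym ∣X∣≤2 (≤-trans 2≤∣Y∣ ∣Y∣≤∣X∣)
    ∣Y∣≡2 = ≤-antisym (≤-trans ∣Y∣≤∣X∣ ∣X∣≤2) 2≤∣Y∣

special⇒Crossing : ∀ {φ : Permutation′ n} → 4 ≤ n → (D : SpecialDecomposition φ) →
                   ∃[ X ] Crossing φ X (proj₁ (parts D)) (proj₂ (parts D))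
special⇒Crossing {n} 4≤n D = go (≤-total ∣ Y ∣ ∣ X ∣)
  where
  open SpecialDecomposition D
  open IsDecomposition isDecomposition
  X = take n (points S₁)
  Y = drop n (points S₁)
  P₁≡ : points S₁ ≡ X ++ Y
  P₁≡ = sym (take++drop≡id n (points S₁))
  P₂≡ : points S₂ ≡ ∁ X ++ ∁ Y
  P₂≡ = trans (∩∪⇒∁ points-disjoint points-cover) (trans (cong ∁ P₁≡) (map-++ not X Y))
  go : ∣ Y ∣ ≤ ∣ X ∣ ⊎ ∣ X ∣ ≤ ∣ Y ∣ → _
  go (inj₁ ∣Y∣≤∣X∣) = X , nonstandard⇒Crossing isDecomposition 4≤n X Y P₁≡ ∣Y∣≤∣X∣ (proj₁ nonstandard₁)
  -- Complementing reverses the inequality, so the second part meets the assumption; exchanging the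
  -- parts back complements once more.
  go (inj₂ ∣X∣≤∣Y∣) = ∁ (∁ X) , Crossing-swap
    (nonstandard⇒Crossing (IsDecomposition-swap isDecomposition) 4≤n (∁ X) (∁ Y) P₂≡
      (subst₂ _≤_ (sym (∣∁p∣≡n∸∣p∣ Y)) (sym (∣∁p∣≡n∸∣p∣ X)) (∸-monoʳ-≤ n ∣X∣≤∣Y∣))
      (proj₁ nonstandard₂))

Crossing⇒n≡4 : ∀ {φ : Permutation′ n} {X S₁ S₂} → Crossing φ X S₁ S₂ → n ≡ 4
Crossing⇒n≡4 {X = X} C = trans (sym (∣p∣+∣∁p∣≡n X)) (cong₂ _+_ size co-size)
  where open Crossing C

-- Conjugate permutations give isomorphic pairs.

lookup-image : ∀ (π : Permutation m n) X y → lookup (image π X) y ≡ lookup X (π ⟨$⟩ˡ y)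
lookup-image π X y = lookup∘tabulate _ y

image-image-flip : ∀ (π : Permutation m n) Y → image π (image (flip π) Y) ≡ Y
image-image-flip π Y = lookup-ext λ y →
  trans (lookup-image π (image (flip π) Y) y)
        (trans (lookup-image (flip π) Y _) (cong (lookup Y) (inverseʳ π)))

image-injective : ∀ (π : Permutation m n) {X Y} → image π X ≡ image π Y → X ≡ Y
image-injective π {X} {Y} eq =
  trans (sym (image-image-flip (flip π) X))
        (trans (cong (image (flip π)) eq) (image-image-flip (flip π) Y))

image-∁ : ∀ (π : Permutation m n) X → image π (∁ X) ≡ ∁ (image π X)
image-∁ π X = trans (tabulate-cong λ y → lookup-∁ X (π ⟨$⟩ˡ y)) (tabulate-∘ not _)

image-⁅⁆ : ∀ (π : Permutation m n) i → image π ｛ i ｝ ≡ ｛ π ⟨$⟩ʳ i ｝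
image-⁅⁆ π i = ⊆-antisym
  (λ {y} y∈ → subst (_∈ ｛ π ⟨$⟩ʳ i ｝)
    (trans (cong (π ⟨$⟩ʳ_) (sym (x∈⁅y⁆⇒x≡y i (true⇒∈ (∈-tabulate⁻ {i = y} y∈))))) (inverseʳ π))
    (x∈⁅x⁆ _))
  (λ y∈ → ∈-tabulate⁺ (∈⇒true (subst (λ z → π ⟨$⟩ˡ z ∈ ｛ i ｝) (sym (x∈⁅y⁆⇒x≡y _ y∈))
    (subst (_∈ ｛ i ｝) (sym (inverseˡ π)) (x∈⁅x⁆ i)))))

-- Relabels the `a i` and the `b i` alike, viewing `Fin (n + n)` as two copies of `Fin n`.
twice : Permutation′ n → Permutation′ (n + n)
twice σ = ↔-sym +↔⊎ ↔-∘ ((σ ⊎-↔ σ) ↔-∘ +↔⊎)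

image-++ : ∀ (σ : Permutation′ n) X Y → image (twice σ) (X ++ Y) ≡ image σ X ++ image σ Y
image-++ {n} σ X Y = lookup-ext λ y →
  trans (lookup-image (twice σ) (X ++ Y) y) (trans (eq y) (sym (lookup-splitAt n (image σ X) (image σ Y) y)))
  where
  eq : ∀ y → lookup (X ++ Y) (twice σ ⟨$⟩ˡ y) ≡ [ lookup (image σ X) , lookup (image σ Y) ]′ (splitAt n y)
  eq y with splitAt n y
  ... | inj₁ i = trans (lookup-++ˡ X Y _) (sym (lookup-image σ X i))
  ... | inj₂ i = trans (lookup-++ʳ X Y _) (sym (lookup-image σ Y i))

module _ {φ ψ : Permutation′ n} (σ : Permutation′ n)
         (σφ≡ψσ : ∀ i → σ ⟨$⟩ʳ (φ ⟨$⟩ʳ i) ≡ ψ ⟨$⟩ʳ (σ ⟨$⟩ʳ i)) where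

  private
    image-∁⁅⁆ : ∀ i → image σ (∁ ｛ i ｝) ≡ ∁ ｛ σ ⟨$⟩ʳ i ｝
    image-∁⁅⁆ i = trans (image-∁ σ ｛ i ｝) (cong ∁ (image-⁅⁆ σ i))

    image-blockA : ∀ i → image (twice σ) (blockA φ i) ≡ blockA ψ (σ ⟨$⟩ʳ i)
    image-blockA i = begin
      image (twice σ) (blockA φ i)              ≡⟨ cong (image (twice σ)) (blockA≡ φ i) ⟩
      image (twice σ) (∁ ｛ i ｝ ++ ｛ i ｝)        ≡⟨ image-++ σ (∁ ｛ i ｝) ｛ i ｝ ⟩
      image σ (∁ ｛ i ｝) ++ image σ ｛ i ｝        ≡⟨ cong₂ _++_ (image-∁⁅⁆ i) (image-⁅⁆ σ i) ⟩
      ∁ ｛ σ ⟨$⟩ʳ i ｝ ++ ｛ σ ⟨$⟩ʳ i ｝            ≡⟨ blockA≡ ψ (σ ⟨$⟩ʳ i) ⟨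
      blockA ψ (σ ⟨$⟩ʳ i)                       ∎
      where open ≡-Reasoning

    -- Here σφ = ψσ enters: the point of the block with index φ i goes to the one with index σ(φ i),
    -- which must be ψ(σ i).
    image-blockB : ∀ i → image (twice σ) (blockB φ i) ≡ blockB ψ (σ ⟨$⟩ʳ i)
    image-blockB i = begin
      image (twice σ) (blockB φ i)                   ≡⟨ cong (image (twice σ)) (blockB≡ φ i) ⟩
      image (twice σ) (｛ φ ⟨$⟩ʳ i ｝ ++ ∁ ｛ i ｝)      ≡⟨ image-++ σ ｛ φ ⟨$⟩ʳ i ｝ (∁ ｛ i ｝) ⟩
      image σ ｛ φ ⟨$⟩ʳ i ｝ ++ image σ (∁ ｛ i ｝)
        ≡⟨ cong₂ _++_ (trans (image-⁅⁆ σ (φ ⟨$⟩ʳ i)) (cong ｛_｝ (σφ≡ψσ i))) (image-∁⁅⁆ i) ⟩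
      ｛ ψ ⟨$⟩ʳ (σ ⟨$⟩ʳ i) ｝ ++ ∁ ｛ σ ⟨$⟩ʳ i ｝        ≡⟨ blockB≡ ψ (σ ⟨$⟩ʳ i) ⟨
      blockB ψ (σ ⟨$⟩ʳ i)                            ∎
      where open ≡-Reasoning

    -- Since j = σ(σ⁻¹ j), the set `f j` is the image of `e` at σ⁻¹ j; injectivity of `image` then
    -- identifies `k`.
    lift-preimage : ∀ {e f : Fin n → Subset (n + n)} →
                    (∀ i → image (twice σ) (e i) ≡ f (σ ⟨$⟩ʳ i)) →
                    ∀ {k} → ∃[ j ] image (twice σ) k ≡ f j → ∃[ i ] k ≡ e i
    lift-preimage {f = f} eq (j , k≡) = σ ⟨$⟩ˡ j , image-injective (twice σ)
      (trans k≡ (sym (trans (eq (σ ⟨$⟩ˡ j)) (cong f (inverseʳ σ)))))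

  conjugate⇒≅ : 𝔐 n φ ≅ 𝔐 n ψ
  conjugate⇒≅ = twice σ , λ k → mk⇔
    (λ { (inj₁ (i , refl)) → inj₁ (σ ⟨$⟩ʳ i , image-blockA i)
       ; (inj₂ (i , refl)) → inj₂ (σ ⟨$⟩ʳ i , image-blockB i) })
    (λ { (inj₁ k∈) → inj₁ (lift-preimage image-blockA k∈)
       ; (inj₂ k∈) → inj₂ (lift-preimage image-blockB k∈) })

≅-sym : ∀ M N → M ≅ N → N ≅ M
≅-sym M N (π , π-iso) = flip π , λ Y → mk⇔
  (λ k → Equivalence.from (π-iso _) (subst (Block N) (sym (image-image-flip π Y)) k))
  (λ k → subst (Block N) (image-image-flip π Y) (Equivalence.to (π-iso _) k))

-- Telling the three pairs apart.

-- Isomorphism invariants, since images commute with complements. In `𝔐 4 φ` the only block that can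
-- be the complement of Aᵢ is Bᵢ, and it is exactly when φ fixes `i`.
Opposed Unopposed : Configuration → Set
Opposed   M = ∀ k → Block M k → Block M (∁ k)
Unopposed M = ∀ k → Block M k → ¬ Block M (∁ k)

≅-Opposed : ∀ M N → M ≅ N → Opposed N → Opposed M
≅-Opposed M N (π , π-iso) opp k k∈ = Equivalence.from (π-iso _)
  (subst (Block N) (sym (image-∁ π k)) (opp _ (Equivalence.to (π-iso k) k∈)))

≅-Unopposed : ∀ M N → M ≅ N → Unopposed N → Unopposed M
≅-Unopposed M N (π , π-iso) unopp k k∈ ∁k∈ = unopp _ (Equivalence.to (π-iso k) k∈)
  (subst (Block N) (image-∁ π k) (Equivalence.to (π-iso _) ∁k∈))

_≟ˢ_ : ∀ (p q : Subset n) → Dec (p ≡ q)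
_≟ˢ_ = ≡-dec _≟ᵇ_

block? : ∀ (φ : Permutation′ n) k → Dec (Block (𝔐 n φ) k)
block? φ k = any? (λ i → k ≟ˢ blockA φ i) ⊎-dec any? (λ i → k ≟ˢ blockB φ i)

opposed-id : Opposed (𝔐 4 idₚ)
opposed-id _ (inj₁ (i , refl)) = from-yes (all? λ i → block? {4} idₚ (∁ (blockA {4} idₚ i))) i
opposed-id _ (inj₂ (i , refl)) = from-yes (all? λ i → block? {4} idₚ (∁ (blockB {4} idₚ i))) i

unopposed-⟨13⟩⟨24⟩ : Unopposed (𝔐 4 ⟨13⟩⟨24⟩)
unopposed-⟨13⟩⟨24⟩ _ (inj₁ (i , refl)) =
  from-yes (all? λ i → ¬? (block? ⟨13⟩⟨24⟩ (∁ (blockA ⟨13⟩⟨24⟩ i)))) i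
unopposed-⟨13⟩⟨24⟩ _ (inj₂ (i , refl)) =
  from-yes (all? λ i → ¬? (block? ⟨13⟩⟨24⟩ (∁ (blockB ⟨13⟩⟨24⟩ i)))) i

id≇⟨13⟩⟨24⟩ : ¬ (𝔐 4 idₚ ≅ 𝔐 4 ⟨13⟩⟨24⟩)
id≇⟨13⟩⟨24⟩ iso =
  ≅-Unopposed (𝔐 4 idₚ) (𝔐 4 ⟨13⟩⟨24⟩) iso unopposed-⟨13⟩⟨24⟩ _ A₁∈ (opposed-id _ A₁∈)
  where
  A₁∈ : Block (𝔐 4 idₚ) (blockA {4} idₚ one)
  A₁∈ = inj₁ (one , refl)

id≇⟨12⟩ : ¬ (𝔐 4 idₚ ≅ 𝔐 4 ⟨12⟩)
-- (12) moves 1, so the complement of A₁ is no block.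
id≇⟨12⟩ iso = from-no (block? ⟨12⟩ (∁ (blockA ⟨12⟩ one)))
  (≅-Opposed (𝔐 4 ⟨12⟩) (𝔐 4 idₚ) (≅-sym (𝔐 4 idₚ) (𝔐 4 ⟨12⟩) iso) opposed-id
             (blockA ⟨12⟩ one) (inj₁ (one , refl)))

⟨13⟩⟨24⟩≇⟨12⟩ : ¬ (𝔐 4 ⟨13⟩⟨24⟩ ≅ 𝔐 4 ⟨12⟩)
⟨13⟩⟨24⟩≇⟨12⟩ iso =
  ≅-Unopposed (𝔐 4 ⟨12⟩) (𝔐 4 ⟨13⟩⟨24⟩) (≅-sym (𝔐 4 ⟨13⟩⟨24⟩) (𝔐 4 ⟨12⟩) iso) unopposed-⟨13⟩⟨24⟩
              -- (12) fixes 3, so A₃ has the block B₃ as its complement.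
              (blockA ⟨12⟩ three) (inj₁ (three , refl))
              (from-yes (block? ⟨12⟩ (∁ (blockA ⟨12⟩ three))))

-- Permutations of four indices with an invariant pair.

-- Products of two transpositions are enough conjugators for the classes of
-- id, (13)(24) and (12) in S₄.
Conjugate : (Fin n → Fin n) → Permutation′ n → Set
Conjugate {n} f ψ = ∃[ i ] ∃[ j ] ∃[ k ] ∃[ l ] ∀ x → let σ = transpose i j ∘ₚ transpose k l in
  σ ⟨$⟩ʳ (f x) ≡ ψ ⟨$⟩ʳ (σ ⟨$⟩ʳ x)

conjugate? : ∀ (f : Fin n → Fin n) ψ → Dec (Conjugate f ψ)
conjugate? f ψ = any? λ i → any? λ j → any? λ k → any? λ l → all? λ x → _ ≟ _

InvariantPair : (Fin 4 → Fin 4) → Subset 4 → Set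
InvariantPair f X = ∣ X ∣ ≡ 2 × (∀ i → lookup X (f i) ≡ lookup X i)

invariantPair? : ∀ f X → Dec (InvariantPair f X)
invariantPair? f X = (∣ X ∣ ≟ℕ 2) ×-dec all? λ i → lookup X (f i) ≟ᵇ lookup X i

Classified : (Fin 4 → Fin 4) → Set
Classified f = Conjugate f idₚ ⊎ Conjugate f ⟨13⟩⟨24⟩ ⊎ Conjugate f ⟨12⟩

-- An invariant 2-subset excludes 3-cycles and 4-cycles, which leaves three cycle types. Maps are
-- given by their four values so that evaluation can run through them; injectivity selects the
-- permutations.
classified : ∀ w x y z → let f = lookup (w ∷ x ∷ y ∷ z ∷ []) in
             (∀ i j → f i ≡ f j → i ≡ j) → ∃[ X ] InvariantPair f X → Classified f
classified = from-yes (all? λ w → all? λ x → all? λ y → all? λ z →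
  let f = lookup (w ∷ x ∷ y ∷ z ∷ []) in
  (all? λ i → all? λ j → (f i ≟ f j) →-dec (i ≟ j)) →-dec
  anySubset? (invariantPair? f) →-dec
  (conjugate? f idₚ ⊎-dec conjugate? f ⟨13⟩⟨24⟩ ⊎-dec conjugate? f ⟨12⟩))

classify : ∀ (φ : Permutation′ 4) → ∃[ X ] InvariantPair (φ ⟨$⟩ʳ_) X →
           𝔐 4 φ ≅ 𝔐 4 idₚ ⊎ 𝔐 4 φ ≅ 𝔐 4 ⟨13⟩⟨24⟩ ⊎ 𝔐 4 φ ≅ 𝔐 4 ⟨12⟩
classify φ (X , ∣X∣≡2 , inv) =
  Sum.map (iso idₚ) (Sum.map (iso ⟨13⟩⟨24⟩) (iso ⟨12⟩))
    (classified _ _ _ _ f-injective (X , ∣X∣≡2 , λ i → trans (cong (lookup X) (f≡ i)) (inv i)))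
  where
  f : Fin 4 → Fin 4
  f = lookup (tabulate (φ ⟨$⟩ʳ_))

  f≡ : ∀ i → f i ≡ φ ⟨$⟩ʳ i
  f≡ = lookup∘tabulate (φ ⟨$⟩ʳ_)

  f-injective : ∀ i j → f i ≡ f j → i ≡ j
  f-injective i j eq = trans (sym (inverseˡ φ))
    (trans (cong (φ ⟨$⟩ˡ_) (trans (sym (f≡ i)) (trans eq (f≡ j)))) (inverseˡ φ))

  iso : ∀ ψ → Conjugate f ψ → 𝔐 4 φ ≅ 𝔐 4 ψ
  iso ψ (i , j , k , l , σf≡ψσ) = let σ = transpose i j ∘ₚ transpose k l in
    conjugate⇒≅ {φ = φ} {ψ} σ λ x → trans (cong (σ ⟨$⟩ʳ_) (sym (f≡ x))) (σf≡ψσ x)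

-- Associated decompositions by finite checks.

Enumerates : (Fin n → Subset m) → Family m → Set
Enumerates e 𝒦 = ∀ k → 𝒦 k ⇔ (∃[ i ] k ≡ e i)

-- Unique existence as cardinalities that evaluate. Applied to the complements of the blocks of a
-- part it yields the simplex condition; applied to the blocks of the other part, inscription.
Tactical : Subset m → (Fin n → Subset m) → Set
Tactical P e = (∀ i → ∣ P ∩ e i ∣ ≡ 1) × (∀ x → x ∈ P → ∣ tabulate (λ i → lookup (e i) x) ∣ ≡ 1)

tactical? : ∀ (P : Subset m) (e : Fin n → Subset m) → Dec (Tactical P e)
tactical? P e = (all? λ i → ∣ P ∩ e i ∣ ≟ℕ 1)
  ×-dec (all? λ x → (x ∈? P) →-dec (∣ tabulate (λ i → lookup (e i) x) ∣ ≟ℕ 1))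

module _ {e : Fin n → Subset m} {𝒦 : Family m} (enum : Enumerates e 𝒦) where

  -- `f` tabulates `R` along the enumeration. Any block satisfying `R` is some `e j` with `j` the
  -- unique index, so uniqueness passes from indices to blocks.
  unique-block : ∀ {R : Subset m → Set} {f : Fin n → Side} →
                 (∀ {i} → f i ≡ true → R (e i)) → (∀ {i} → R (e i) → f i ≡ true) →
                 ∣ tabulate f ∣ ≡ 1 → ∃! _≡_ λ k → 𝒦 k × R k
  unique-block {R} to from eq with ∣p∣≡1⇒∃! eq
  ... | i , i∈ , unique =
    e i , (Equivalence.from (enum (e i)) (i , refl) , to (∈-tabulate⁻ i∈)) , unique′
    where
    unique′ : ∀ {k} → 𝒦 k × R k → e i ≡ k
    unique′ {k} (k∈ , Rk) with Equivalence.to (enum k) k∈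
    ... | j , refl = cong e (unique (∈-tabulate⁺ (from Rk)))

  unique-point : ∀ {P k} → (∀ i → ∣ P ∩ e i ∣ ≡ 1) → 𝒦 k → ∃! _≡_ λ x → x ∈ P × x ∈ k
  unique-point {k = k} eq k∈ with Equivalence.to (enum k) k∈
  ... | j , refl = ∃!-map (x∈p∩q⁻ _ _) x∈p∩q⁺ (∣p∣≡1⇒∃! (eq j))

  tactical⇒IsSimplex : ∀ {P} → Tactical P (∁ ∘ e) → IsSimplex ⟪ P , 𝒦 ⟫
  tactical⇒IsSimplex (per-block , per-point) = record
    { point-misses-one-block = λ {x} x∈ →
        unique-block {R = x ∉_} (λ eq → x∈∁p⇒x∉p (true⇒∈ eq)) (λ x∉ → ∈⇒true (x∉p⇒x∈∁p x∉)) (per-point x x∈)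
    ; block-misses-one-point = λ {k} k∈ → misses (Equivalence.to (enum k) k∈)
    }
    where
    misses : ∀ {k} → ∃[ i ] k ≡ e i → ∃! _≡_ _
    misses (i , refl) = ∃!-map
      (λ x∈ → let x∈P , x∈∁ = x∈p∩q⁻ _ _ x∈ in x∈P , x∈∁p⇒x∉p x∈∁)
      (λ (x∈P , x∉) → x∈p∩q⁺ (x∈P , x∉p⇒x∈∁p x∉)) (∣p∣≡1⇒∃! (per-block i))

-- One clause comes from each hypothesis: the points of `S` against the blocks `f`, and the blocks
-- `e` against the points of `T`.
tactical⇒Inscribed : ∀ {S T : Part m} {e f : Fin n → Subset m} →
                     Enumerates e (blocks S) → Enumerates f (blocks T) →
                     Tactical (points S) f → Tactical (points T) e → Inscribed S T
tactical⇒Inscribed enumS enumT (_ , per-point) (per-block , _) = record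
  { point-on-one-block      = λ {x} x∈ → unique-block enumT {R = x ∈_} true⇒∈ ∈⇒true (per-point x x∈)
  ; block-through-one-point = unique-point enumS per-block
  }

-- Lists the blocks of the associated simplex, one of Aᵢ and Bᵢ per index; with `∁ X` for `X` it
-- picks the other one each time.
crossBlock : Permutation′ n → Subset n → Fin n → Subset (n + n)
crossBlock φ X i = if lookup X i then blockB φ i else blockA φ i

crossBlock-∈ : ∀ (φ : Permutation′ n) {X i} → i ∈ X → crossBlock φ X i ≡ blockB φ i
crossBlock-∈ φ {i = i} i∈X = cong (if_then blockB φ i else blockA φ i) (∈⇒true i∈X)

crossBlock-∉ : ∀ (φ : Permutation′ n) {X i} → i ∉ X → crossBlock φ X i ≡ blockA φ i
crossBlock-∉ φ {i = i} i∉X = cong (if_then blockB φ i else blockA φ i) (∉⇒false i∉X)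

module _ (φ : Permutation′ 4) (X : Subset 4) where

  private
    S T : Part (4 + 4)
    S = associatedPart φ X
    T = remainingPart φ S

  enumerate-S : Enumerates (crossBlock φ X) (blocks S)
  enumerate-S k = mk⇔ to (λ (i , eq) → from i eq)
    where
    to : blocks S k → ∃[ i ] k ≡ crossBlock φ X i
    to (inj₁ (i , i∈X , eq)) = i , trans eq (sym (crossBlock-∈ φ i∈X))
    to (inj₂ (i , i∉X , eq)) = i , trans eq (sym (crossBlock-∉ φ i∉X))
    from : ∀ i → k ≡ crossBlock φ X i → blocks S k
    from i eq with i ∈? X
    ... | yes i∈X = inj₁ (i , i∈X , trans eq (crossBlock-∈ φ i∈X))
    ... | no  i∉X = inj₂ (i , i∉X , trans eq (crossBlock-∉ φ i∉X))

  -- The remaining part is defined by exclusion, so the listed blocks also have to avoid the first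
  -- list.
  enumerate-T : (∀ i j → crossBlock φ X i ≢ crossBlock φ (∁ X) j) →
                Enumerates (crossBlock φ (∁ X)) (blocks T)
  enumerate-T disjoint k = mk⇔ to
    (λ (i , eq) → from i eq , λ k∈S → outside-S i eq (Equivalence.to (enumerate-S k) k∈S))
    where
    to : blocks T k → ∃[ i ] k ≡ crossBlock φ (∁ X) i
    to (inj₁ (i , eq) , k∉S) with i ∈? X
    ... | yes i∈X = i , trans eq (sym (crossBlock-∉ φ (x∈p⇒x∉∁p i∈X)))
    ... | no  i∉X = contradiction (inj₂ (i , i∉X , eq)) k∉S
    to (inj₂ (i , eq) , k∉S) with i ∈? X
    ... | yes i∈X = contradiction (inj₁ (i , i∈X , eq)) k∉S
    ... | no  i∉X = i , trans eq (sym (crossBlock-∈ φ (x∉p⇒x∈∁p i∉X)))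
    from : ∀ i → k ≡ crossBlock φ (∁ X) i → Block (𝔐 4 φ) k
    from i eq with i ∈? ∁ X
    ... | yes i∈ = inj₂ (i , trans eq (crossBlock-∈ φ i∈))
    ... | no  i∉ = inj₁ (i , trans eq (crossBlock-∉ φ i∉))
    outside-S : ∀ i → k ≡ crossBlock φ (∁ X) i → ¬ (∃[ j ] k ≡ crossBlock φ X j)
    outside-S i eq (j , eq′) = disjoint j i (trans (sym eq′) eq)

  -- Gathers in decidable form what is left to check for a special decomposition. Being nonstandard
  -- is asked of the point sets alone, which already distinguish the parts.
  Valid : Set
  Valid = let P = points S ; Q = points T ; e = crossBlock φ X ; f = crossBlock φ (∁ X) in
      (∣ P ∣ ≡ 4 × ∣ Q ∣ ≡ 4)
    × ((∀ i j → e i ≡ e j → i ≡ j) × (∀ i j → f i ≡ f j → i ≡ j) × (∀ i j → e i ≢ f j))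
    × (Tactical P (∁ ∘ e) × Tactical Q (∁ ∘ f) × Tactical P f × Tactical Q e)
    × (P ≢ A 4 × P ≢ B 4 × Q ≢ A 4 × Q ≢ B 4)

  valid? : Dec Valid
  valid? = let P = points S ; Q = points T ; e = crossBlock φ X ; f = crossBlock φ (∁ X) in
      ((∣ P ∣ ≟ℕ 4) ×-dec (∣ Q ∣ ≟ℕ 4))
    ×-dec ((all? λ i → all? λ j → (e i ≟ˢ e j) →-dec (i ≟ j))
      ×-dec (all? λ i → all? λ j → (f i ≟ˢ f j) →-dec (i ≟ j))
      ×-dec (all? λ i → all? λ j → ¬? (e i ≟ˢ f j)))
    ×-dec (tactical? P (∁ ∘ e) ×-dec tactical? Q (∁ ∘ f) ×-dec tactical? P f ×-dec tactical? Q e)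
    ×-dec (¬? (P ≟ˢ A 4) ×-dec ¬? (P ≟ˢ B 4) ×-dec ¬? (Q ≟ˢ A 4) ×-dec ¬? (Q ≟ˢ B 4))

  associatedDecomposition : Valid → SpecialDecomposition φ
  associatedDecomposition
    ((∣P∣ , ∣Q∣) , (e-inj , f-inj , e≢f) , (Pe , Qf , Pf , Qe) , (P≢A , P≢B , Q≢A , Q≢B)) = record
    { S₁ = S
    ; S₂ = T
    ; isDecomposition = record
      { points-size₁    = ∣P∣
      ; points-size₂    = ∣Q∣
      ; points-disjoint = ∩-inverseʳ (points S)
      ; points-cover    = p∪∁p≡⊤ (points S)
      ; blocks-size₁    = crossBlock φ X , e-inj _ _ , enumerate-S
      ; blocks-size₂    = crossBlock φ (∁ X) , f-inj _ _ , enumerate-T e≢f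
      ; blocks-disjoint = λ { (k∈S , _ , k∉S) → k∉S k∈S }
      ; blocks-cover    = [ S⊆ , proj₁ ]′ , λ {k} → split k
      ; simplex₁        = tactical⇒IsSimplex enumerate-S Pe
      ; simplex₂        = tactical⇒IsSimplex (enumerate-T e≢f) Qf
      ; inscribed₁₂     = tactical⇒Inscribed enumerate-S (enumerate-T e≢f) Pf Qe
      ; inscribed₂₁     = tactical⇒Inscribed (enumerate-T e≢f) enumerate-S Qe Pf
      }
    ; nonstandard₁ = P≢A ∘ proj₁ , P≢B ∘ proj₁
    ; nonstandard₂ = Q≢A ∘ proj₁ , Q≢B ∘ proj₁
    }
    where
    S⊆ : ∀ {k} → blocks S k → Block (𝔐 4 φ) k
    S⊆ (inj₁ (i , _ , eq)) = inj₂ (i , eq)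
    S⊆ (inj₂ (i , _ , eq)) = inj₁ (i , eq)
    split : ∀ k → Block (𝔐 4 φ) k → blocks S k ⊎ blocks T k
    split k k∈ with map′ (Equivalence.from (enumerate-S k)) (Equivalence.to (enumerate-S k))
                         (any? λ i → k ≟ˢ crossBlock φ X i)
    ... | yes k∈S = inj₁ k∈S
    ... | no  k∉S = inj₂ (k∈ , k∉S)

  -- Each Aᵢ and Bᵢ is placed by `Crossing`, and `disjoint` keeps it out of the other part, so both
  -- families are forced.
  Crossing⇒≈ : ∀ {S₁ S₂} → Crossing φ X S₁ S₂ → S₁ ≈ S × S₂ ≈ T
  Crossing⇒≈ {S₁} {S₂} C =
      (points₁ , to₁ , from₁)
    , (trans points₂ (sym (trans (map-++ not X (∁ X)) (cong (∁ X ++_) (∁-involutive X)))) , to₂ , from₂)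
    where
    open Crossing C
    from₁ : ∀ {k} → blocks S k → blocks S₁ k
    from₁ (inj₁ (i , i∈X , refl)) = proj₁ (blocks-∈ i∈X)
    from₁ (inj₂ (i , i∉X , refl)) = proj₁ (blocks-∉ i∉X)
    to₂ : ∀ {k} → blocks S₂ k → blocks T k
    to₂ k∈ = proj₁ cover (inj₂ k∈) , λ k∈S → disjoint (from₁ k∈S , k∈)
    to₁ : ∀ {k} → blocks S₁ k → blocks S k
    to₁ k∈ with proj₁ cover (inj₁ k∈)
    ... | inj₁ (i , refl) with i ∈? X
    ...   | yes i∈X = ⊥-elim (disjoint (k∈ , proj₂ (blocks-∈ i∈X)))
    ...   | no  i∉X = inj₂ (i , i∉X , refl)
    to₁ k∈ | inj₂ (i , refl) with i ∈? X
    ...   | yes i∈X = inj₁ (i , i∈X , refl)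
    ...   | no  i∉X = ⊥-elim (disjoint (k∈ , proj₂ (blocks-∉ i∉X)))
    from₂ : ∀ {k} → blocks T k → blocks S₂ k
    from₂ (k∈ , k∉S) with proj₂ cover k∈
    ... | inj₁ k∈₁ = contradiction (to₁ k∈₁) k∉S
    ... | inj₂ k∈₂ = k∈₂

  Associated : Part (4 + 4) × Part (4 + 4) → Set
  Associated Q = Q ≈ᵘ (S , T)

  associatedWith : (v : Valid) → ∣ X ∣ ≡ 2 → image φ X ≡ X →
                   AssociatedWith X (associatedDecomposition v)
  associatedWith _ ∣X∣≡2 inv = record
    { size-two   = ∣X∣≡2
    ; invariant  = inv
    ; parts-of-X = inj₁ ((refl , (λ k → k) , λ k → k) , (refl , (λ k → k) , λ k → k))
    }

-- Special decompositions of the three pairs.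

-- `X` and `∁ X` yield the same unordered decomposition; both forms are recorded so that either may
-- be matched with a prescribed pair.
special⇒associated : ∀ {φ : Permutation′ 4} (D : SpecialDecomposition φ) →
  ∃[ X ] InvariantPair (φ ⟨$⟩ʳ_) X × Associated φ X (parts D) × Associated φ (∁ X) (parts D)
special⇒associated {φ} D with special⇒Crossing (s≤s (s≤s (s≤s (s≤s z≤n)))) D
... | X , C = X , (Crossing.size C , Crossing.invariant C) , inj₁ (Crossing⇒≈ φ X C) ,
  inj₂ (let S₂≈ , S₁≈ = Crossing⇒≈ φ (∁ X) (Crossing-swap C) in S₁≈ , S₂≈)

-- Searches for a counterexample; decidability of `P X` removes the double negation.
∀-subset? : ∀ {P : Subset n → Set} → (∀ X → Dec (P X)) → Dec (∀ X → P X)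
∀-subset? P? = map′ (λ ¬∃ X → decidable-stable (P? X) λ ¬PX → ¬∃ (X , ¬PX))
                    (λ ∀P (X , ¬PX) → ¬PX (∀P X)) (¬? (anySubset? (¬? ∘ P?)))

IsOrComplement : Subset n → Subset n → Set
IsOrComplement Y X = X ≡ Y ⊎ ∁ X ≡ Y

isOrComplement? : ∀ (Y X : Subset n) → Dec (IsOrComplement Y X)
isOrComplement? Y X = (X ≟ˢ Y) ⊎-dec (∁ X ≟ˢ Y)

associated-to : ∀ φ X Y {Q} → Associated φ X Q → Associated φ (∁ X) Q →
                IsOrComplement Y X → Associated φ Y Q
associated-to _ _ _ asc _ (inj₁ refl) = asc
associated-to _ _ _ _ asc (inj₂ refl) = asc

-- A special decomposition is determined by its invariant pair up to complement, so one such pair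
-- leaves one decomposition.
uniqueSpecial : ∀ φ Y → Valid φ Y → ∣ Y ∣ ≡ 2 → image φ Y ≡ Y →
                (∀ X → InvariantPair (φ ⟨$⟩ʳ_) X → IsOrComplement Y X) → UniqueSpecial φ Y
uniqueSpecial φ Y v ∣Y∣≡2 inv only =
  associatedDecomposition φ Y v , associatedWith φ Y v ∣Y∣≡2 inv , λ E →
    let X , pair , asc , asc′ = special⇒associated E in associated-to φ X Y asc asc′ (only X pair)

unique-⟨13⟩⟨24⟩ : UniqueSpecial ⟨13⟩⟨24⟩ ⁅ one , three ⁆
unique-⟨13⟩⟨24⟩ =
  uniqueSpecial ⟨13⟩⟨24⟩ ⁅ one , three ⁆ (from-yes (valid? ⟨13⟩⟨24⟩ ⁅ one , three ⁆)) refl refl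
    (from-yes (∀-subset? {4} λ X → invariantPair? (⟨13⟩⟨24⟩ ⟨$⟩ʳ_) X →-dec isOrComplement? ⁅ one , three ⁆ X))

unique-⟨12⟩ : UniqueSpecial ⟨12⟩ ⁅ one , two ⁆
unique-⟨12⟩ =
  uniqueSpecial ⟨12⟩ ⁅ one , two ⁆ (from-yes (valid? ⟨12⟩ ⁅ one , two ⁆)) refl refl
    (from-yes (∀-subset? {4} λ X → invariantPair? (⟨12⟩ ⟨$⟩ʳ_) X →-dec isOrComplement? ⁅ one , two ⁆ X))

three-id : ThreeSpecial idₚ ⁅ one , two ⁆ ⁅ one , three ⁆ ⁅ one , four ⁆
three-id =
    associatedDecomposition idₚ X₁₂ v₁₂
  , associatedDecomposition idₚ X₁₃ v₁₃
  , associatedDecomposition idₚ X₁₄ v₁₄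
  , ( associatedWith idₚ X₁₂ v₁₂ refl refl
    , associatedWith idₚ X₁₃ v₁₃ refl refl
    , associatedWith idₚ X₁₄ v₁₄ refl refl )
  -- In either order the point sets to be equal are distinct concrete vectors.
  , ( (λ { (inj₁ ((() , _) , _)) ; (inj₂ ((() , _) , _)) })
    , (λ { (inj₁ ((() , _) , _)) ; (inj₂ ((() , _) , _)) })
    , (λ { (inj₁ ((() , _) , _)) ; (inj₂ ((() , _) , _)) }) )
  , λ G → let X , (∣X∣≡2 , _) , asc , asc′ = special⇒associated G in
    Sum.map (associated-to idₚ X X₁₂ asc asc′)
      (Sum.map (associated-to idₚ X X₁₃ asc asc′) (associated-to idₚ X X₁₄ asc asc′))
      (pairs X ∣X∣≡2)
  where
  X₁₂ X₁₃ X₁₄ : Subset 4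
  X₁₂ = ⁅ one , two ⁆
  X₁₃ = ⁅ one , three ⁆
  X₁₄ = ⁅ one , four ⁆
  v₁₂ = from-yes (valid? idₚ X₁₂)
  v₁₃ = from-yes (valid? idₚ X₁₃)
  v₁₄ = from-yes (valid? idₚ X₁₄)
  -- The six 2-subsets form three complementary pairs, represented by those containing 1.
  pairs : ∀ X → ∣ X ∣ ≡ 2 → IsOrComplement X₁₂ X ⊎ IsOrComplement X₁₃ X ⊎ IsOrComplement X₁₄ X
  pairs = from-yes (∀-subset? {4} λ X → (∣ X ∣ ≟ℕ 2) →-dec
    (isOrComplement? X₁₂ X ⊎-dec isOrComplement? X₁₃ X ⊎-dec isOrComplement? X₁₄ X))

-- Classification of the pairs with a special decomposition.

special⇒standard-form : ∀ n → 4 ≤ n → (φ : Permutation′ n) → SpecialDecomposition φ →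
  𝔐 n φ ≅ 𝔐 4 idₚ ⊎ 𝔐 n φ ≅ 𝔐 4 ⟨13⟩⟨24⟩ ⊎ 𝔐 n φ ≅ 𝔐 4 ⟨12⟩
special⇒standard-form n 4≤n φ D with special⇒Crossing 4≤n D
... | X , C with Crossing⇒n≡4 C
... | refl = classify φ (X , Crossing.size C , Crossing.invariant C)

corollary2p4 :
    (∀ (n : ℕ) → 4 ≤ n → (φ : Permutation′ n) → SpecialDecomposition φ →
      𝔐 n φ ≅ 𝔐 4 idₚ ⊎ 𝔐 n φ ≅ 𝔐 4 ⟨13⟩⟨24⟩ ⊎ 𝔐 n φ ≅ 𝔐 4 ⟨12⟩)
    × ThreeSpecial idₚ ⁅ one , two ⁆ ⁅ one , three ⁆ ⁅ one , four ⁆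
    × UniqueSpecial ⟨13⟩⟨24⟩ ⁅ one , three ⁆
    × UniqueSpecial ⟨12⟩ ⁅ one , two ⁆
    × ¬ (𝔐 4 idₚ ≅ 𝔐 4 ⟨13⟩⟨24⟩)
    × ¬ (𝔐 4 idₚ ≅ 𝔐 4 ⟨12⟩)
    × ¬ (𝔐 4 ⟨13⟩⟨24⟩ ≅ 𝔐 4 ⟨12⟩)
corollary2p4 = special⇒standard-form , three-id , unique-⟨13⟩⟨24⟩ , unique-⟨12⟩
             , id≇⟨13⟩⟨24⟩ , id≇⟨12⟩ , ⟨13⟩⟨24⟩≇⟨12⟩
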